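{- For every finite additive poset $A$, $h(A)\le\dim(A)\le wt(A)\le w(A)$.
   Context: An additive poset is a pair $(A,\le)$ where $A$ is an abelian group and $\le$ is a partial order on $A$ such that for all $a,b,c\in A$: $(\ast)$ if $b\le a$ and $c\le a$ then $b+c\le a$; $(\ast\ast)$ if $a\le b$ and $a\le c$ then $a\le a+b+c$. Such $A$ is a $\mathbb{Z}/2\mathbb{Z}$-vector space; $\dim(A)$ is its dimension. The height $h(A)$ is the maximal length $n$ of a chain $a_0<a_1<\cdots<a_n$ in $A$; the width $w(A)$ is the maximal cardinality of an antichain (set of pairwise incomparable elements); the weight $wt(A)$ is the number of atoms, where an atom is a nonzero $a$ with $\{x:x\le a\}=\{0,a\}$. -}

module Defs where

open import Algebra.Bundles using (AbelianGroup; CommutativeRing)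
open import Algebra.Module.Bundles using (Module)
open import Algebra.Module.Structures.Biased using (IsModuleFromLeft)
open import Algebra.Properties.Monoid.Sum using (sum)
open import Data.Bool using (Bool; true; false)
open import Data.Bool.Properties using (xor-∧-commutativeRing)
open import Data.Fin using (Fin; suc; inject₁)
open import Data.Nat as ℕ using (ℕ)
open import Data.Product using (Σ; ∃; _×_)
open import Data.Sum using (_⊎_)
open import Function.Bundles using (Inverse; _⇔_)
open import Function.Definitions using (Injective)
open import Level using (Level; _⊔_) renaming (suc to lsuc)
open import Relation.Binary using (Rel; IsPartialOrder)
open import Relation.Binary.PropositionalEquality as ≡ using (_≡_; _≢_)
open import Relation.Nullary using (¬_)
import Relation.Binary.Construct.NonStrictToStrict as NonStrictToStrict

module _ {r ℓr m ℓm : Level} {R : CommutativeRing r ℓr} (M : Module R m ℓm) where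
  open CommutativeRing R using (Carrier; _≈_; 0#)
  open Module M

  linearCombination : {n : ℕ} → (Fin n → Carrier) → (Fin n → Carrierᴹ) → Carrierᴹ
  linearCombination c e = sum +ᴹ-monoid (λ i → c i *ₗ e i)

  LinearlyIndependent : {n : ℕ} → (Fin n → Carrierᴹ) → Set (r ⊔ ℓr ⊔ ℓm)
  LinearlyIndependent e = ∀ c → linearCombination c e ≈ᴹ 0ᴹ → ∀ i → c i ≈ 0#

  Spanning : {n : ℕ} → (Fin n → Carrierᴹ) → Set (r ⊔ m ⊔ ℓm)
  Spanning e = ∀ x → ∃ λ c → linearCombination c e ≈ᴹ x

  IsBasis : {n : ℕ} → (Fin n → Carrierᴹ) → Set (r ⊔ ℓr ⊔ m ⊔ ℓm)
  IsBasis e = LinearlyIndependent e × Spanning e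

  HasDimension : ℕ → Set (r ⊔ ℓr ⊔ m ⊔ ℓm)
  HasDimension n = Σ (Fin n → Carrierᴹ) IsBasis

IsMaximum : {p : Level} → (ℕ → Set p) → ℕ → Set p
IsMaximum P n = P n × (∀ m → P m → m ℕ.≤ n)

record AdditivePoset (a ℓ₁ ℓ₂ : Level) : Set (lsuc (a ⊔ ℓ₁ ⊔ ℓ₂)) where
  field
    abelianGroup : AbelianGroup a ℓ₁

  open AbelianGroup abelianGroup public
    renaming (_∙_ to infixl 6 _+_; ε to 0#; _⁻¹ to infix 8 -_)

  infix 4 _≤_
  field
    _≤_            : Rel Carrier ℓ₂
    isPartialOrder : IsPartialOrder _≈_ _≤_
    +-below        : ∀ a b c → b ≤ a → c ≤ a → b + c ≤ a
    +-above        : ∀ a b c → a ≤ b → a ≤ c → a ≤ a + b + c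

  open IsPartialOrder isPartialOrder public
    using (antisym; ≤-respˡ-≈; ≤-respʳ-≈)
    renaming (refl to ≤-refl; trans to ≤-trans; reflexive to ≤-reflexive)

  open NonStrictToStrict _≈_ _≤_ public using (_<_)

  x+x≈0 : ∀ x → x + x ≈ 0#
  x+x≈0 x = trans (sym (identityʳ (x + x)))
    (trans (∙-congˡ (sym (inverseʳ x)))
    (trans (sym (assoc (x + x) x (- x)))
    (trans (∙-congʳ x+x+x≈x) (inverseʳ x))))
    where
    x+x+x≈x : x + x + x ≈ x
    x+x+x≈x = antisym
      (+-below x (x + x) x (+-below x x x ≤-refl ≤-refl) ≤-refl)
      (+-above x x x ≤-refl ≤-refl)

  infixr 7 _·_
  _·_ : Bool → Carrier → Carrier
  false · x = 0#
  true  · x = x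

  -- The field ℤ/2ℤ is Bool with xor as addition and ∧ as multiplication.
  vectorSpace : Module xor-∧-commutativeRing a ℓ₁
  vectorSpace = record
    { _*ₗ_ = _·_
    ; _*ᵣ_ = λ x c → c · x
    ; isModule = IsModuleFromLeft.isModule
        {commutativeRing = xor-∧-commutativeRing}
        (record { isLeftModule = record
          { isLeftSemimodule = record
            { +ᴹ-isCommutativeMonoid = isCommutativeMonoid
            ; isPreleftSemimodule = record
              { *ₗ-cong      = ·-cong
              ; *ₗ-zeroˡ     = λ _ → refl
              ; *ₗ-distribʳ  = ·-distribʳ
              ; *ₗ-identityˡ = λ _ → refl
              ; *ₗ-assoc     = ·-assoc
              ; *ₗ-zeroʳ     = ·-zeroʳ
              ; *ₗ-distribˡ  = ·-distribˡ
              }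
            }
          ; -ᴹ‿cong    = ⁻¹-cong
          ; -ᴹ‿inverse = inverse
          } })
    }
    where
    open CommutativeRing xor-∧-commutativeRing using () renaming (_+_ to _⊕_; _*_ to _⊗_)

    ·-cong : ∀ {c d x y} → c ≡ d → x ≈ y → c · x ≈ d · y
    ·-cong {false} ≡.refl _   = refl
    ·-cong {true}  ≡.refl x≈y = x≈y

    ·-distribʳ : ∀ x c d → (c ⊕ d) · x ≈ c · x + d · x
    ·-distribʳ x false d     = sym (identityˡ (d · x))
    ·-distribʳ x true  false = sym (identityʳ x)
    ·-distribʳ x true  true  = sym (x+x≈0 x)

    ·-assoc : ∀ c d x → (c ⊗ d) · x ≈ c · (d · x)
    ·-assoc false _ _ = refl
    ·-assoc true  _ _ = refl

    ·-zeroʳ : ∀ c → c · 0# ≈ 0#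
    ·-zeroʳ false = refl
    ·-zeroʳ true  = refl

    ·-distribˡ : ∀ c x y → c · (x + y) ≈ c · x + c · y
    ·-distribˡ false _ _ = sym (identityˡ 0#)
    ·-distribˡ true  _ _ = refl

  IsFinite : Set (a ⊔ ℓ₁)
  IsFinite = ∃ λ n → Inverse setoid (≡.setoid (Fin n))

  IsDimension : ℕ → Set (a ⊔ ℓ₁)
  IsDimension = HasDimension vectorSpace

  -- A chain of length n has n + 1 elements.
  IsChain : {n : ℕ} → (Fin (ℕ.suc n) → Carrier) → Set (ℓ₁ ⊔ ℓ₂)
  IsChain {n} x = ∀ (i : Fin n) → x (inject₁ i) < x (suc i)

  IsHeight : ℕ → Set (a ⊔ ℓ₁ ⊔ ℓ₂)
  IsHeight = IsMaximum λ n → Σ (Fin (ℕ.suc n) → Carrier) IsChain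

  Incomparable : Carrier → Carrier → Set ℓ₂
  Incomparable x y = ¬ (x ≤ y) × ¬ (y ≤ x)

  -- An antichain of cardinality n, given by listing its elements without repetition.
  IsAntichain : {n : ℕ} → (Fin n → Carrier) → Set (ℓ₁ ⊔ ℓ₂)
  IsAntichain x = Injective _≡_ _≈_ x × (∀ i j → i ≢ j → Incomparable (x i) (x j))

  IsWidth : ℕ → Set (a ⊔ ℓ₁ ⊔ ℓ₂)
  IsWidth = IsMaximum λ n → Σ (Fin n → Carrier) IsAntichain

  IsAtom : Carrier → Set (a ⊔ ℓ₁ ⊔ ℓ₂)
  IsAtom x = ¬ (x ≈ 0#) × (∀ y → (y ≤ x) ⇔ (y ≈ 0# ⊎ y ≈ x))

  -- The listing is repetition-free, sound and complete for the atoms.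
  IsWeight : ℕ → Set (a ⊔ ℓ₁ ⊔ ℓ₂)
  IsWeight n = Σ (Fin n → Carrier) λ x →
    Injective _≡_ _≈_ x × (∀ i → IsAtom (x i)) × (∀ y → IsAtom y → ∃ λ i → x i ≈ y)

{-# OPTIONS --safe #-}
-- The lower set of an element is a subgroup, by (∗).  Along a chain these subgroups
-- grow strictly, so the elements of the chain after the first are independent: h ≤ dim.
-- If 0 < y < x, then x = y + (x + y) with both summands strictly below x, so by
-- induction the atoms span A: dim ≤ wt.  The atoms form an antichain: wt ≤ w.
module Submission where

open import Defs
open import Algebra.Bundles using (CommutativeRing)
open import Algebra.Module.Bundles using (Module)
import Algebra.Properties.CommutativeMonoid.Sum as CommutativeMonoidSum
import Algebra.Properties.Monoid.Sum as MonoidSum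
open import Data.Bool using (Bool; true; false; _xor_)
open import Data.Bool.Properties using (xor-∧-commutativeRing; xor-same)
open import Data.Empty using (⊥-elim)
open import Data.Fin using (Fin; zero; suc; combine; finToFun; funToFin)
open import Data.Fin.Induction using (spo-wellFounded)
open import Data.Fin.Properties as Fin
  using (2↔Bool; finToFun-funToFin; funToFin-finToFin; injective⇒≤; sequence)
open import Data.Nat using (ℕ; _≤_; _^_; s≤s; z≤n)
open import Data.Nat.Properties using (_≤?_; ≤⇒≯; ≰⇒>; ^-monoʳ-<)
open import Data.Product using (_×_; _,_; proj₁; proj₂; ∃)
open import Data.Sum using (_⊎_; inj₁; inj₂)
open import Data.Vec.Functional using (_∷_)
open import Effect.Monad using (RawMonad)
open import Function using (_∘_)
open import Function.Bundles using (Inverse; Equivalence; mk⇔)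
import Function.Properties.Inverse as InverseProperties
open import Induction.WellFounded using (WellFounded; module Subrelation; module All)
open import Level using (Level; _⊔_)
import Relation.Binary.Construct.NonStrictToStrict as NonStrictToStrict
import Relation.Binary.Construct.On as On
open import Relation.Binary.Definitions using (Decidable)
open import Relation.Binary.PropositionalEquality as ≡ using (_≡_; _≢_; _≗_)
import Relation.Binary.Reasoning.Setoid as SetoidReasoning
open import Relation.Nullary using (¬_; yes; no; contradiction)
open import Relation.Nullary.Decidable using (decidable-stable; via-injection)
open import Relation.Nullary.Negation using (¬¬-Monad; ¬¬-map)

-- Finite functions and double negation

private
  variable
    m n : ℕ

-- Double negation is an applicative functor, so finitely many doubly negated facts can be combined
-- under a single double negation.
¬¬-∀-Fin : ∀ {p} {P : Fin n → Set p} → (∀ i → ¬ ¬ P i) → ¬ ¬ (∀ i → P i)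
¬¬-∀-Fin = sequence (RawMonad.rawApplicative ¬¬-Monad)

-- Pointwise equal functions need not be propositionally equal, so this goes by induction on the
-- domain.
funToFin-cong : {f g : Fin m → Fin n} → f ≗ g → funToFin f ≡ funToFin g
funToFin-cong {ℕ.zero}  f≗g = ≡.refl
funToFin-cong {ℕ.suc m} f≗g = ≡.cong₂ combine (f≗g zero) (funToFin-cong (f≗g ∘ suc))

finToFun-injective : {i j : Fin (m ^ n)} → finToFun {m} {n} i ≗ finToFun j → i ≡ j
finToFun-injective {m} {n} {i} {j} eq =
  ≡.trans (≡.sym (funToFin-finToFin {n} {m} i))
  (≡.trans (funToFin-cong eq) (funToFin-finToFin {n} {m} j))

2^-cancel-≤ : 2 ^ m ≤ 2 ^ n → m ≤ n
2^-cancel-≤ {m} {n} 2^m≤2^n = decidable-stable (m ≤? n) λ m≰n →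
  ≤⇒≯ 2^m≤2^n (^-monoʳ-< 2 (s≤s (s≤s z≤n)) (≰⇒> m≰n))

xor≡false⇒≡ : ∀ c d → c xor d ≡ false → c ≡ d
xor≡false⇒≡ false false _ = ≡.refl
xor≡false⇒≡ true  true  _ = ≡.refl

-- Linear combinations and spans

module LinearCombination {r ℓr a ℓ : Level} {R : CommutativeRing r ℓr} (M : Module R a ℓ) where
  open CommutativeRing R using (Carrier; _≈_; _+_; 0#; 1#)
  open Module M
  open SetoidReasoning ≈ᴹ-setoid

  linearCombination-cong : {c d : Fin n → Carrier} (e : Fin n → Carrierᴹ) →
    (∀ i → c i ≈ d i) → linearCombination M c e ≈ᴹ linearCombination M d e
  linearCombination-cong e c≈d =
    MonoidSum.sum-cong-≋ +ᴹ-monoid (λ i → *ₗ-cong (c≈d i) ≈ᴹ-refl)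

  linearCombination-0 : (e : Fin n → Carrierᴹ) → linearCombination M (λ _ → 0#) e ≈ᴹ 0ᴹ
  linearCombination-0 {n} e = ≈ᴹ-trans
    (MonoidSum.sum-cong-≋ +ᴹ-monoid (λ i → *ₗ-zeroˡ (e i)))
    (MonoidSum.sum-replicate-zero +ᴹ-monoid n)

  linearCombination-+ : (c d : Fin n → Carrier) (e : Fin n → Carrierᴹ) →
    linearCombination M (λ i → c i + d i) e ≈ᴹ linearCombination M c e +ᴹ linearCombination M d e
  linearCombination-+ c d e = ≈ᴹ-trans
    (MonoidSum.sum-cong-≋ +ᴹ-monoid (λ i → *ₗ-distribʳ (e i) (c i) (d i)))
    (CommutativeMonoidSum.∑-distrib-+ +ᴹ-commutativeMonoid (λ i → c i *ₗ e i) (λ i → d i *ₗ e i))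

  InSpan : (Fin n → Carrierᴹ) → Carrierᴹ → Set (r ⊔ ℓ)
  InSpan e x = ∃ λ c → linearCombination M c e ≈ᴹ x

  inSpan-resp : {e : Fin n → Carrierᴹ} {x y : Carrierᴹ} → x ≈ᴹ y → InSpan e x → InSpan e y
  inSpan-resp x≈y (c , eq) = c , ≈ᴹ-trans eq x≈y

  inSpan-0 : (e : Fin n → Carrierᴹ) → InSpan e 0ᴹ
  inSpan-0 e = (λ _ → 0#) , linearCombination-0 e

  inSpan-+ : {e : Fin n → Carrierᴹ} {x y : Carrierᴹ} → InSpan e x → InSpan e y → InSpan e (x +ᴹ y)
  inSpan-+ {e = e} (c , cx) (d , dy) =
    (λ i → c i + d i) , ≈ᴹ-trans (linearCombination-+ c d e) (+ᴹ-cong cx dy)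

  inSpan-member : (e : Fin n → Carrierᴹ) (i : Fin n) → InSpan e (e i)
  inSpan-member e zero = 1# ∷ (λ _ → 0#) , (begin
    1# *ₗ e zero +ᴹ linearCombination M (λ _ → 0#) (e ∘ suc)
      ≈⟨ +ᴹ-cong (*ₗ-identityˡ (e zero)) (linearCombination-0 (e ∘ suc)) ⟩
    e zero +ᴹ 0ᴹ
      ≈⟨ +ᴹ-identityʳ (e zero) ⟩
    e zero ∎)
  inSpan-member e (suc i) = let c , eq = inSpan-member (e ∘ suc) i in 0# ∷ c , (begin
    0# *ₗ e zero +ᴹ linearCombination M c (e ∘ suc)
      ≈⟨ +ᴹ-cong (*ₗ-zeroˡ (e zero)) eq ⟩
    0ᴹ +ᴹ e (suc i)
      ≈⟨ +ᴹ-identityˡ (e (suc i)) ⟩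
    e (suc i) ∎)

-- Independence and spanning over ℤ/2ℤ

module _ {a ℓ : Level} (M : Module xor-∧-commutativeRing a ℓ) where
  open Module M
  open LinearCombination M
  open SetoidReasoning ≈ᴹ-setoid

  -- In characteristic 2 the difference of two coefficient families is their `xor`, and its
  -- combination vanishes when the two combinations agree.
  linearlyIndependent⇒injective : {e : Fin m → Carrierᴹ} → LinearlyIndependent M e →
    ∀ c d → linearCombination M c e ≈ᴹ linearCombination M d e → c ≗ d
  linearlyIndependent⇒injective {e = e} independent c d eq i =
    xor≡false⇒≡ (c i) (d i) (independent (λ j → c j xor d j) sum≈0 i)
    where
    sum≈0 : linearCombination M (λ j → c j xor d j) e ≈ᴹ 0ᴹ
    sum≈0 = begin
      linearCombination M (λ j → c j xor d j) e
        ≈⟨ linearCombination-+ c d e ⟩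
      linearCombination M c e +ᴹ linearCombination M d e
        ≈⟨ +ᴹ-congʳ eq ⟩
      linearCombination M d e +ᴹ linearCombination M d e
        -- The doubled combination is moved back into the coefficients, where `d j xor d j` is
        -- `false`.
        ≈⟨ linearCombination-+ d d e ⟨
      linearCombination M (λ j → d j xor d j) e
        ≈⟨ linearCombination-cong e (λ j → xor-same (d j)) ⟩
      linearCombination M (λ _ → false) e
        ≈⟨ linearCombination-0 e ⟩
      0ᴹ ∎

  -- Over ℤ/2ℤ the exchange lemma reduces to counting: the 2 ^ m combinations of an
  -- independent family are distinct, and each is among the 2 ^ n of a spanning one.
  independent≤spanning : {e : Fin m → Carrierᴹ} {f : Fin n → Carrierᴹ} →
    LinearlyIndependent M e → Spanning M f → m ≤ n
  independent≤spanning {m} {n} {e} {f} independent spanning =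
    2^-cancel-≤ (injective⇒≤ re-express-injective)
    where
    open Inverse 2↔Bool using () renaming
      (to to bit; from to digit; strictlyInverseˡ to bit-digit; strictlyInverseʳ to digit-bit)

    combination : Fin (2 ^ m) → Carrierᴹ
    combination i = linearCombination M (bit ∘ finToFun i) e

    coefficients : Carrierᴹ → Fin n → Bool
    coefficients x = proj₁ (spanning x)

    re-express : Fin (2 ^ m) → Fin (2 ^ n)
    re-express i = funToFin (digit ∘ coefficients (combination i))

    digit-injective : ∀ {b c} → digit b ≡ digit c → b ≡ c
    digit-injective {b} {c} eq = ≡.trans (≡.sym (bit-digit b)) (≡.trans (≡.cong bit eq) (bit-digit c))

    bit-injective : ∀ {p q} → bit p ≡ bit q → p ≡ q
    bit-injective {p} {q} eq = ≡.trans (≡.sym (digit-bit p)) (≡.trans (≡.cong digit eq) (digit-bit q))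

    re-express-injective : ∀ {i j} → re-express i ≡ re-express j → i ≡ j
    re-express-injective {i} {j} eq = finToFun-injective λ k → bit-injective
      (linearlyIndependent⇒injective independent (bit ∘ finToFun i) (bit ∘ finToFun j) same-combination k)
      where
      same-coefficients : coefficients (combination i) ≗ coefficients (combination j)
      same-coefficients k = digit-injective (≡.trans
        (≡.sym (finToFun-funToFin (digit ∘ coefficients (combination i)) k))
        (≡.trans (≡.cong (λ t → finToFun t k) eq)
        (finToFun-funToFin (digit ∘ coefficients (combination j)) k)))

      same-combination : combination i ≈ᴹ combination j
      same-combination = begin
        combination i
          ≈⟨ proj₂ (spanning (combination i)) ⟨
        linearCombination M (coefficients (combination i)) f
          ≈⟨ linearCombination-cong f same-coefficients ⟩
        linearCombination M (coefficients (combination j)) f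
          ≈⟨ proj₂ (spanning (combination j)) ⟩
        combination j ∎

-- Chains and atoms in an additive poset

module _ {a ℓ₁ ℓ₂ : Level} (A : AdditivePoset a ℓ₁ ℓ₂) where
  open AdditivePoset A renaming (_≤_ to _⊑_; _<_ to _⊏_; ≤-refl to ⊑-refl; ≤-trans to ⊑-trans)
  open LinearCombination vectorSpace

  -- By (∗), `x + x` is below `x`, and `x + x` is zero.
  0-minimum : ∀ x → 0# ⊑ x
  0-minimum x = ≤-respˡ-≈ (x+x≈0 x) (+-below x x x ⊑-refl ⊑-refl)

  x+[x+y]≈y : ∀ x y → x + (x + y) ≈ y
  x+[x+y]≈y x y = trans (sym (assoc x x y)) (trans (∙-congʳ (x+x≈0 x)) (identityˡ y))

  ·-below : ∀ c {x y} → x ⊑ y → c · x ⊑ y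
  ·-below false {y = y} _ = 0-minimum y
  ·-below true  x⊑y       = x⊑y

  -- Independence is strengthened for the induction: the combination need only lie below `x zero`, a
  -- hypothesis that passes to the tail of the chain. For an empty family nothing is to be proved,
  -- so one clause suffices.
  chain-coefficients≡false : (x : Fin (ℕ.suc n) → Carrier) → IsChain x → (c : Fin n → Bool) →
    linearCombination vectorSpace c (x ∘ suc) ⊑ x zero → ∀ i → c i ≡ false
  chain-coefficients≡false {ℕ.suc n} x chain c sum⊑x₀ = λ where
      zero    → c₀≡false (c zero) head⊑x₀
      (suc i) → tail≡false i
    where
    x₀ = x zero
    x₁ = x (suc zero)
    tail = linearCombination vectorSpace (c ∘ suc) (x ∘ suc ∘ suc)

    tail⊑x₁ : tail ⊑ x₁
    -- `tail` is the sum of `c zero · x₁` and the whole combination; the first is below `x₁`, the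
    -- second below `x₀` and hence below `x₁`.
    tail⊑x₁ = ≤-respˡ-≈ (x+[x+y]≈y (c zero · x₁) tail)
      (+-below x₁ _ _ (·-below (c zero) ⊑-refl) (⊑-trans sum⊑x₀ (proj₁ (chain zero))))

    tail≡false : ∀ i → c (suc i) ≡ false
    tail≡false = chain-coefficients≡false (x ∘ suc) (chain ∘ suc) (c ∘ suc) tail⊑x₁

    tail≈0 : tail ≈ 0#
    tail≈0 = trans (linearCombination-cong (x ∘ suc ∘ suc) tail≡false)
      (linearCombination-0 (x ∘ suc ∘ suc))

    head⊑x₀ : c zero · x₁ ⊑ x₀
    head⊑x₀ = ≤-respˡ-≈ (trans (∙-congˡ tail≈0) (identityʳ (c zero · x₁))) sum⊑x₀

    c₀≡false : ∀ b → b · x₁ ⊑ x₀ → b ≡ false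
    c₀≡false false _     = ≡.refl
    -- A coefficient `true` would put `x₁` below `x₀`, against the strictness of the chain.
    c₀≡false true  x₁⊑x₀ = contradiction (antisym (proj₁ (chain zero)) x₁⊑x₀) (proj₂ (chain zero))

  chain-linearlyIndependent : (x : Fin (ℕ.suc n) → Carrier) → IsChain x →
    LinearlyIndependent vectorSpace (x ∘ suc)
  chain-linearlyIndependent x chain c sum≈0 =
    chain-coefficients≡false x chain c (≤-respˡ-≈ (sym sum≈0) (0-minimum (x zero)))

  -- Below an atom lie only zero and the atom itself, so one atom below another equals it.
  atoms-antichain : {x : Fin n → Carrier} → (∀ {i j} → x i ≈ x j → i ≡ j) →
    (∀ i → IsAtom (x i)) → IsAntichain x
  atoms-antichain {x = x} injective atom =
    injective , λ i j i≢j → not-below i≢j , not-below (i≢j ∘ ≡.sym)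
    where
    not-below : ∀ {i j} → i ≢ j → ¬ x i ⊑ x j
    not-below {i} {j} i≢j xᵢ⊑xⱼ with Equivalence.to (proj₂ (atom j) (x i)) xᵢ⊑xⱼ
    ... | inj₁ xᵢ≈0  = proj₁ (atom i) xᵢ≈0
    ... | inj₂ xᵢ≈xⱼ = i≢j (injective xᵢ≈xⱼ)

  -- Finite additive posets: atoms span

  module _ (finite : IsFinite) where
    open Inverse (proj₂ finite) using (to; from; strictlyInverseʳ)

    infix 4 _≈?_
    _≈?_ : Decidable _≈_
    _≈?_ = via-injection (InverseProperties.Inverse⇒Injection (proj₂ finite)) Fin._≟_

    -- Carried to `Fin` along `from`, the order is a strict partial order on a finite set, hence
    -- well-founded; this is pulled back along `to`.
    ⊏-wellFounded : WellFounded _⊏_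
    ⊏-wellFounded = Subrelation.wellFounded
      (λ {x} {y} (x⊑y , x≉y) →
          ≤-respˡ-≈ (sym (strictlyInverseʳ x)) (≤-respʳ-≈ (sym (strictlyInverseʳ y)) x⊑y)
        , λ eq → x≉y (trans (sym (strictlyInverseʳ x)) (trans eq (strictlyInverseʳ y))))
      (On.wellFounded to (spo-wellFounded
        (On.isStrictPartialOrder from (NonStrictToStrict.<-isStrictPartialOrder _≈_ _⊑_ isPartialOrder))))

    ¬¬-∀ : ∀ {p} {P : Carrier → Set p} → (∀ {x y} → x ≈ y → P x → P y) →
      (∀ x → ¬ ¬ P x) → ¬ ¬ (∀ x → P x)
    ¬¬-∀ resp p = ¬¬-map (λ q x → resp (strictlyInverseʳ x) (q (to x))) (¬¬-∀-Fin (p ∘ from))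

    -- The order is not assumed decidable, so one cannot decide whether x is an atom;
    -- the double negation is harmless because it is used to prove a decidable inequality.
    atoms-span : {e : Fin n → Carrier} → (∀ x → IsAtom x → ∃ λ i → e i ≈ x) →
      ¬ ¬ Spanning vectorSpace e
    atoms-span {e = e} complete = ¬¬-∀ inSpan-resp (All.wfRec ⊏-wellFounded _ _ step)
      where
      step : ∀ x → (∀ {y} → y ⊏ x → ¬ ¬ InSpan e y) → ¬ ¬ InSpan e x
      -- Assuming that `x` is outside the span makes `x` an atom, so `x` is listed in `e` and lies
      -- in the span after all.
      step x rec x∉span = x∉span
        (let i , eᵢ≈x = complete x atom in inSpan-resp eᵢ≈x (inSpan-member e i))
        where
        below : ∀ y → y ⊑ x → y ≈ 0# ⊎ y ≈ x
        below y y⊑x with y ≈? 0# | y ≈? x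
        ... | yes y≈0 | _       = inj₁ y≈0
        ... | no _    | yes y≈x = inj₂ y≈x
        ... | no y≉0  | no y≉x  = ⊥-elim
          -- Both `y` and `y + x` are strictly below `x` and their sum is `x`. The goal is a
          -- contradiction, so the doubly negated induction hypotheses can be used as if they were
          -- plain.
          (rec (y⊑x , y≉x) λ y∈span →
           rec (+-below x y x y⊑x ⊑-refl , y+x≉x) λ y+x∈span →
           x∉span (inSpan-resp (x+[x+y]≈y y x) (inSpan-+ y∈span y+x∈span)))
          where
          y+x≉x : ¬ y + x ≈ x
          y+x≉x eq = y≉0 (trans (sym (x+[x+y]≈y x y)) (trans (∙-congˡ (trans (comm x y) eq)) (x+x≈0 x)))

        atom : IsAtom x
        atom = (λ x≈0 → x∉span (inSpan-resp (sym x≈0) (inSpan-0 e)))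
             , λ y → mk⇔ (below y) λ where
                 (inj₁ y≈0) → ≤-respˡ-≈ (sym y≈0) (0-minimum x)
                 (inj₂ y≈x) → ≤-reflexive y≈x

theorem7p1 : {a ℓ₁ ℓ₂ : Level} (A : AdditivePoset a ℓ₁ ℓ₂) → AdditivePoset.IsFinite A →
    (h d wt w : ℕ) → AdditivePoset.IsHeight A h → AdditivePoset.IsDimension A d →
    AdditivePoset.IsWeight A wt → AdditivePoset.IsWidth A w →
    (h ≤ d) × (d ≤ wt) × (wt ≤ w)
theorem7p1 A finite h d wt w ((x , chain) , _) (_ , independent , spanning)
  (atoms , injective , atom , complete) (_ , maximal) =
    -- A chain of length `h` has `h + 1` elements; without the first, exactly `h` independent ones
    -- remain to compare with the spanning basis.
    independent≤spanning V (chain-linearlyIndependent A x chain) spanning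
  , decidable-stable (d ≤? wt) (¬¬-map (independent≤spanning V independent) (atoms-span A finite complete))
  , maximal wt (atoms , atoms-antichain A injective atom)
  where V = AdditivePoset.vectorSpace A
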